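{- For every integer $t \ge 3$, the integer $4t+2$ is a magic constant.
   Context: All graphs $G=(V,E)$ are finite, simple (undirected, no loops or multiple edges), with nonempty vertex set, and not necessarily connected. A positive integer $k$ is called a magic constant if there exist a graph $G=(V,E)$ and a bijection $f: V \to \{1,2,\dots,|V|\}$ such that for every vertex $v \in V$ the weight $w(v) = \sum_{u \in N(v)} f(u)$ equals $k$, where $N(v) = \{u \in V : uv \in E\}$ is the (open) neighborhood of $v$. -}

module Defs where

open import Data.Fin.Base using (Fin; toℕ)
open import Data.List.Base using (List; allFin; filter; map; sum)
open import Data.Nat.Base using (ℕ; suc; _<_)
open import Data.Product.Base using (_×_; Σ-syntax)
open import Function.Bundles using (_⤖_; module Bijection)
open import Level using (0ℓ)
open import Relation.Binary.Core using (Rel)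
open import Relation.Binary.Definitions using (Decidable; Irreflexive; Symmetric)
open import Relation.Binary.PropositionalEquality.Core using (_≡_)

-- The vertex set is Fin order, which loses no generality up to isomorphism.
-- Adjacency is decidable so that neighbourhoods can be enumerated.
record Graph : Set₁ where
  infix 4 _~_ _~?_
  field
    order    : ℕ
    nonempty : 0 < order
    _~_      : Rel (Fin order) 0ℓ
    _~?_     : Decidable _~_
    ~-sym    : Symmetric _~_
    ~-irrefl : Irreflexive _≡_ _~_

  Vertex : Set
  Vertex = Fin order

  -- The open neighbourhood; allFin has no repetitions, so neither does this.
  N : Vertex → List Vertex
  N v = filter (v ~?_) (allFin order)

-- A bijection V → {1,…,|V|}, where i : Fin |V| stands for the label 1 + toℕ i.
Labelling : Graph → Set
Labelling G = Vertex ⤖ Fin order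
  where open Graph G

module _ (G : Graph) (f : Labelling G) where
  open Graph G

  label : Vertex → ℕ
  label u = suc (toℕ (Bijection.to f u))

  weight : Vertex → ℕ
  weight v = sum (map label (N v))

-- Positivity is a genuine requirement: edgeless graphs have all weights 0.
IsMagicConstant : ℕ → Set₁
IsMagicConstant k =
  0 < k × (Σ[ G ∈ Graph ] Σ[ f ∈ Labelling G ] (∀ v → weight G f v ≡ k))

{-# OPTIONS --safe #-}
module Submission where

-- Replace every vertex of a cycle C_t (t ≥ 3) by two non-adjacent twins, and label each pair of
-- twins by two numbers i and 2t + 1 − i. A vertex is adjacent to the two pairs over the
-- neighbours of its image in C_t, so every weight is 2(2t + 1) = 4t + 2.

open import Defs
open import Data.Nat.Base using (ℕ; _+_; _*_; _≤_)

open import Algebra.Properties.CommutativeSemigroup using (interchange; x∙yz≈y∙xz)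
open import Data.Fin.Base using (Fin; zero; suc; toℕ; fromℕ; opposite; punchIn; splitAt; _↑ˡ_; _↑ʳ_)
open import Data.Fin.Permutation
  using (Permutation′; id; insert; reverse; _⟨$⟩ʳ_; _⟨$⟩ˡ_; inverseˡ; inverseʳ)
open import Data.Fin.Properties
  using (_≟_; +↔⊎; opposite-prop; splitAt-↑ˡ; splitAt-↑ʳ; suc-injective; toℕ-↑ˡ; toℕ-↑ʳ; toℕ<n)
open import Data.List.Base using ([]; _∷_; _++_; allFin; filter; map; tabulate)
open import Data.List.Properties
  using (filter-++; filter-none; filter-≐; map-++; map-cong; map-∘; map-tabulate)
open import Data.List.Relation.Unary.All.Properties using (tabulate⁺)
open import Data.Nat.Base using (zero; suc; _∸_; s≤s; z≤n; z<s)
open import Data.Nat.ListAction using (sum)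
open import Data.Nat.ListAction.Properties using (sum-++)
open import Data.Nat.Properties using (+-assoc; +-commutativeSemigroup; m+[n∸m]≡n; m≢1+n+m)
open import Data.Nat.Tactic.RingSolver using (solve-∀)
open import Data.Product.Base using (_,_)
open import Data.Sum.Base using (_⊎_; [_,_]′; swap)
open import Data.Sum.Function.Propositional using (_⊎-↔_)
open import Function.Base using (_∘_) renaming (id to identity)
open import Function.Bundles using (module Inverse; _↔_)
open import Function.Properties.Inverse using (↔-refl; ↔-sym; ↔-trans; ↔⇒⤖)
open import Level using (0ℓ)
open import Relation.Binary.PropositionalEquality
  using (_≡_; _≢_; refl; sym; trans; cong; cong₂; subst; module ≡-Reasoning)
open import Relation.Nullary.Decidable.Core using (yes; no)
open import Relation.Nullary.Negation.Core using (¬_; contradiction)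
open import Relation.Unary using (Pred; Decidable)
open import Relation.Unary.Properties using (_∪?_)

private
  variable
    A B : Set
    n : ℕ

filter-map : {P : Pred B 0ℓ} (P? : Decidable P) (h : A → B) →
             ∀ xs → filter P? (map h xs) ≡ map h (filter (P? ∘ h) xs)
filter-map P? h []       = refl
filter-map P? h (x ∷ xs) with P? (h x)
... | yes _ = cong (h x ∷_) (filter-map P? h xs)
... | no  _ = filter-map P? h xs

sum-map-+ : (g h : A → ℕ) → ∀ xs →
            sum (map g xs) + sum (map h xs) ≡ sum (map (λ x → g x + h x) xs)
sum-map-+ g h []       = refl
sum-map-+ g h (x ∷ xs) = trans
  (interchange +-commutativeSemigroup (g x) _ (h x) _)
  (cong (g x + h x +_) (sum-map-+ g h xs))

-- Disjointness keeps any entry from being counted twice. It will separate the successor from the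
-- predecessor of a vertex on its cycle.
sum-filter-∪ : {P Q : Pred A 0ℓ} (P? : Decidable P) (Q? : Decidable Q) →
               (∀ {x} → P x → ¬ Q x) → (g : A → ℕ) → ∀ xs →
               sum (map g (filter (P? ∪? Q?) xs)) ≡
               sum (map g (filter P? xs)) + sum (map g (filter Q? xs))
sum-filter-∪ P? Q? P⇒¬Q g []       = refl
sum-filter-∪ P? Q? P⇒¬Q g (x ∷ xs) with P? x | Q? x
... | yes p | yes q = contradiction q (P⇒¬Q p)
... | yes _ | no  _ = trans (cong (g x +_) (sum-filter-∪ P? Q? P⇒¬Q g xs)) (sym (+-assoc (g x) _ _))
... | no  _ | yes _ = trans (cong (g x +_) (sum-filter-∪ P? Q? P⇒¬Q g xs))
    (x∙yz≈y∙xz +-commutativeSemigroup (g x) (sum (map g (filter P? xs))) _)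
... | no  _ | no  _ = sum-filter-∪ P? Q? P⇒¬Q g xs

allFin-suc : ∀ n → allFin (suc n) ≡ zero ∷ map suc (allFin n)
allFin-suc n = cong (zero ∷_) (sym (map-tabulate identity suc))

allFin-+ : ∀ m n → allFin (m + n) ≡ map (_↑ˡ n) (allFin m) ++ map (m ↑ʳ_) (allFin n)
allFin-+ zero    n = sym (map-tabulate identity identity)
allFin-+ (suc m) n = begin
  allFin (suc m + n)
    ≡⟨ allFin-suc (m + n) ⟩
  zero ∷ map suc (allFin (m + n))
    ≡⟨ cong (λ xs → zero ∷ map suc xs) (allFin-+ m n) ⟩
  zero ∷ map suc (map (_↑ˡ n) (allFin m) ++ map (m ↑ʳ_) (allFin n))
    ≡⟨ cong (zero ∷_) (map-++ suc (map (_↑ˡ n) (allFin m)) _) ⟩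
  zero ∷ map suc (map (_↑ˡ n) (allFin m)) ++ map suc (map (m ↑ʳ_) (allFin n))
    -- Fusing and unfusing the maps suffices because `suc i ↑ˡ n` and `suc m ↑ʳ i` compute to
    -- `suc (i ↑ˡ n)` and `suc (m ↑ʳ i)`.
    ≡⟨ cong (zero ∷_) (cong₂ _++_ (trans (sym (map-∘ (allFin m))) (map-∘ (allFin m))) (sym (map-∘ (allFin n)))) ⟩
  zero ∷ map (_↑ˡ n) (map suc (allFin m)) ++ map (suc m ↑ʳ_) (allFin n)
    ≡⟨ cong (λ xs → map (_↑ˡ n) xs ++ map (suc m ↑ʳ_) (allFin n)) (allFin-suc m) ⟨
  map (_↑ˡ n) (allFin (suc m)) ++ map (suc m ↑ʳ_) (allFin n) ∎
  where open ≡-Reasoning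

filter-≟ : (w : Fin n) → filter (w ≟_) (allFin n) ≡ w ∷ []
filter-≟ {suc n} zero = cong (zero ∷_) (filter-none (zero ≟_) (tabulate⁺ {f = suc} λ _ ()))
filter-≟ {suc n} (suc w) = begin
  filter (suc w ≟_) (tabulate suc)
    ≡⟨ cong (filter (suc w ≟_)) (map-tabulate identity suc) ⟨
  filter (suc w ≟_) (map suc (allFin n))
    ≡⟨ filter-map (suc w ≟_) suc (allFin n) ⟩
  map suc (filter ((suc w ≟_) ∘ suc) (allFin n))
    ≡⟨ cong (map suc) (filter-≐ ((suc w ≟_) ∘ suc) (w ≟_) (suc-injective , cong suc) (allFin n)) ⟩
  map suc (filter (w ≟_) (allFin n))
    ≡⟨ cong (map suc) (filter-≟ w) ⟩
  suc w ∷ [] ∎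
  where open ≡-Reasoning

-- The projection that identifies twins: the fibre over `i` consists of `i ↑ˡ n` and `n ↑ʳ i`.
base : ∀ n → Fin (n + n) → Fin n
base n x = [ identity , identity ]′ (splitAt n x)

base-↑ˡ : (i : Fin n) → base n (i ↑ˡ n) ≡ i
base-↑ˡ {n} i = cong [ identity , identity ]′ (splitAt-↑ˡ n i n)

base-↑ʳ : (i : Fin n) → base n (n ↑ʳ i) ≡ i
base-↑ʳ {n} i = cong [ identity , identity ]′ (splitAt-↑ʳ n n i)

filter-section : {P : Pred A 0ℓ} (P? : Decidable P) (r : B → A) (s : A → B) →
                 (∀ x → r (s x) ≡ x) →
                 ∀ xs → filter (P? ∘ r) (map s xs) ≡ map s (filter P? xs)
filter-section {P = P} P? r s r∘s xs = trans
  (filter-map (P? ∘ r) s xs)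
  (cong (map s) (filter-≐ (P? ∘ r ∘ s) P?
    ((λ {x} → subst P (r∘s x)) , (λ {x} → subst P (sym (r∘s x)))) xs))

-- Summation along the fibres of `base`: a predicate that factors through `base` selects both twins
-- or neither. This turns a weight in the doubled graph into a sum over neighbours on the cycle.
sum-filter-base : {P : Pred (Fin n) 0ℓ} (P? : Decidable P) (g : Fin (n + n) → ℕ) →
                  sum (map g (filter (P? ∘ base n) (allFin (n + n)))) ≡
                  sum (map (λ i → g (i ↑ˡ n) + g (n ↑ʳ i)) (filter P? (allFin n)))
sum-filter-base {n} P? g = begin
  sum (map g (filter (P? ∘ base n) (allFin (n + n))))
    ≡⟨ cong (λ xs → sum (map g (filter (P? ∘ base n) xs))) (allFin-+ n n) ⟩
  sum (map g (filter (P? ∘ base n) (map (_↑ˡ n) (allFin n) ++ map (n ↑ʳ_) (allFin n))))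
    ≡⟨ cong (sum ∘ map g) (filter-++ (P? ∘ base n) (map (_↑ˡ n) (allFin n)) _) ⟩
  sum (map g (filter (P? ∘ base n) (map (_↑ˡ n) (allFin n)) ++ filter (P? ∘ base n) (map (n ↑ʳ_) (allFin n))))
    ≡⟨ cong (sum ∘ map g) (cong₂ _++_
         (filter-section P? (base n) (_↑ˡ n) base-↑ˡ (allFin n))
         (filter-section P? (base n) (n ↑ʳ_) base-↑ʳ (allFin n))) ⟩
  sum (map g (map (_↑ˡ n) ps ++ map (n ↑ʳ_) ps))
    ≡⟨ cong sum (map-++ g (map (_↑ˡ n) ps) _) ⟩
  sum (map g (map (_↑ˡ n) ps) ++ map g (map (n ↑ʳ_) ps))
    ≡⟨ sum-++ (map g (map (_↑ˡ n) ps)) _ ⟩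
  sum (map g (map (_↑ˡ n) ps)) + sum (map g (map (n ↑ʳ_) ps))
    ≡⟨ cong₂ _+_ (cong sum (map-∘ ps)) (cong sum (map-∘ ps)) ⟨
  sum (map (λ i → g (i ↑ˡ n)) ps) + sum (map (λ i → g (n ↑ʳ i)) ps)
    ≡⟨ sum-map-+ (g ∘ (_↑ˡ n)) (g ∘ (n ↑ʳ_)) ps ⟩
  sum (map (λ i → g (i ↑ˡ n) + g (n ↑ʳ i)) ps) ∎
  where
  open ≡-Reasoning
  ps = filter P? (allFin n)

-- Reversing the second half makes the labels of the twins i ↑ˡ n and n ↑ʳ i add up to 2n + 1.
reverse-right : ∀ n → Fin (n + n) ↔ Fin (n + n)
reverse-right n = ↔-trans (+↔⊎ {n} {n}) (↔-trans (↔-refl ⊎-↔ reverse) (↔-sym (+↔⊎ {n} {n})))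

reverse-right-↑ˡ : (i : Fin n) → Inverse.to (reverse-right n) (i ↑ˡ n) ≡ i ↑ˡ n
reverse-right-↑ˡ {n} i rewrite splitAt-↑ˡ n i n = refl

reverse-right-↑ʳ : (i : Fin n) → Inverse.to (reverse-right n) (n ↑ʳ i) ≡ n ↑ʳ opposite i
reverse-right-↑ʳ {n} i rewrite splitAt-↑ʳ n n i = refl

twin-labels : (i : Fin n) →
              suc (toℕ (Inverse.to (reverse-right n) (i ↑ˡ n))) +
              suc (toℕ (Inverse.to (reverse-right n) (n ↑ʳ i))) ≡ suc (n + n)
twin-labels {n} i = begin
  suc (toℕ (Inverse.to (reverse-right n) (i ↑ˡ n))) + suc (toℕ (Inverse.to (reverse-right n) (n ↑ʳ i)))
    ≡⟨ cong₂ (λ x y → suc (toℕ x) + suc (toℕ y)) (reverse-right-↑ˡ i) (reverse-right-↑ʳ i) ⟩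
  suc (toℕ (i ↑ˡ n)) + suc (toℕ (n ↑ʳ opposite i))
    ≡⟨ cong₂ (λ a b → suc a + suc b) (toℕ-↑ˡ i n)
         (trans (toℕ-↑ʳ n (opposite i)) (cong (n +_) (opposite-prop i))) ⟩
  suc (toℕ i) + suc (n + (n ∸ suc (toℕ i)))
    ≡⟨ rearrange (suc (toℕ i)) n (n ∸ suc (toℕ i)) ⟩
  suc (n + (suc (toℕ i) + (n ∸ suc (toℕ i))))
    -- The truncated subtraction is exact because `toℕ i < n`.
    ≡⟨ cong (λ a → suc (n + a)) (m+[n∸m]≡n (toℕ<n i)) ⟩
  suc (n + n) ∎
  where
  open ≡-Reasoning
  rearrange : ∀ a b c → a + suc (b + c) ≡ suc (b + (a + c))
  rearrange = solve-∀

-- The two hypotheses say that every cycle of `π` has length at least 3. Joining each `u` to its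
-- image then gives a disjoint union of cycles: there are no loops, and the image and preimage of
-- `u` are two distinct neighbours.
module TwinCycles {n} (π : Permutation′ (suc n))
  (π-derangement  : ∀ u → π ⟨$⟩ʳ u ≢ u)
  (π²-derangement : ∀ u → π ⟨$⟩ʳ (π ⟨$⟩ʳ u) ≢ u)
  where

  infix 4 _∼ᶜ_

  _∼ᶜ_ : Fin (suc n) → Fin (suc n) → Set
  u ∼ᶜ v = π ⟨$⟩ʳ u ≡ v ⊎ π ⟨$⟩ʳ v ≡ u

  next? : ∀ u → Decidable (λ v → π ⟨$⟩ʳ u ≡ v)
  next? u v = π ⟨$⟩ʳ u ≟ v

  prev? : ∀ u → Decidable (λ v → π ⟨$⟩ʳ v ≡ u)
  prev? u v = π ⟨$⟩ʳ v ≟ u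

  graph : Graph
  graph = record
    { order    = suc n + suc n
    ; nonempty = z<s
    ; _~_      = λ x y → base (suc n) x ∼ᶜ base (suc n) y
    ; _~?_     = λ x y → (next? (base (suc n) x) ∪? prev? (base (suc n) x)) (base (suc n) y)
    ; ~-sym    = swap
    -- Adjacency sees only the bases, so the same argument shows that twins are non-adjacent.
    ; ~-irrefl = λ { {x} refl → [ π-derangement (base (suc n) x) , π-derangement (base (suc n) x) ]′ }
    }

  labelling : Labelling graph
  labelling = ↔⇒⤖ (reverse-right (suc n))

  filter-next : ∀ u → filter (next? u) (allFin (suc n)) ≡ (π ⟨$⟩ʳ u) ∷ []
  filter-next u = filter-≟ (π ⟨$⟩ʳ u)

  -- Applying the inverse of `π` turns the test into an equality with one fixed vertex, which
  -- `filter-≟` handles.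
  filter-prev : ∀ u → filter (prev? u) (allFin (suc n)) ≡ (π ⟨$⟩ˡ u) ∷ []
  filter-prev u = trans
    (filter-≐ (prev? u) ((π ⟨$⟩ˡ u) ≟_)
      ((λ { refl → inverseˡ π }) , (λ { refl → inverseʳ π })) (allFin (suc n)))
    (filter-≟ (π ⟨$⟩ˡ u))

  weight-constant : ∀ x → weight graph labelling x ≡ 4 * suc n + 2
  weight-constant x = begin
    weight graph labelling x
      ≡⟨ sum-filter-base (next? u ∪? prev? u) (label graph labelling) ⟩
    sum (map _ (filter (next? u ∪? prev? u) vs))
      -- From here on the labels have disappeared: each neighbour on the cycle contributes the same
      -- constant.
      ≡⟨ cong sum (map-cong twin-labels (filter (next? u ∪? prev? u) vs)) ⟩
    sum (map c (filter (next? u ∪? prev? u) vs))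
      -- A vertex that is both successor and predecessor of `u` would make `u` a fixed point of the
      -- square of `π`.
      ≡⟨ sum-filter-∪ (next? u) (prev? u) (λ { refl → π²-derangement u }) c vs ⟩
    sum (map c (filter (next? u) vs)) + sum (map c (filter (prev? u) vs))
      ≡⟨ cong₂ (λ xs ys → sum (map c xs) + sum (map c ys)) (filter-next u) (filter-prev u) ⟩
    suc (suc n + suc n) + 0 + (suc (suc n + suc n) + 0)
      ≡⟨ double (suc n) ⟩
    4 * suc n + 2 ∎
    where
    open ≡-Reasoning
    u = base (suc n) x
    vs = allFin (suc n)
    c : Fin (suc n) → ℕ
    c _ = suc (suc n + suc n)
    double : ∀ m → suc (m + m) + 0 + (suc (m + m) + 0) ≡ 4 * m + 2
    double = solve-∀

-- u ↦ u − 1 modulo n + 1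
rotate : Permutation′ (suc n)
rotate {n} = insert zero (fromℕ n) id

-- The hole is at the top, so no smaller value is shifted.
toℕ-punchIn-fromℕ : (i : Fin n) → toℕ (punchIn (fromℕ n) i) ≡ toℕ i
toℕ-punchIn-fromℕ zero    = refl
toℕ-punchIn-fromℕ (suc i) = cong suc (toℕ-punchIn-fromℕ i)

toℕ-rotate-suc : (i : Fin n) → toℕ (rotate ⟨$⟩ʳ suc i) ≡ toℕ i
toℕ-rotate-suc i = toℕ-punchIn-fromℕ i

rotate-derangement : (u : Fin (2 + n)) → rotate ⟨$⟩ʳ u ≢ u
rotate-derangement zero    ()
rotate-derangement (suc i) eq =
  m≢1+n+m (toℕ i) {0} (trans (sym (toℕ-rotate-suc i)) (cong toℕ eq))

rotate²-derangement : (u : Fin (3 + n)) → rotate ⟨$⟩ʳ (rotate ⟨$⟩ʳ u) ≢ u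
-- The two wrap-around cases: with `3 + n` points, 0 goes to `1 + n` and 1 goes to `2 + n`. On two
-- points 1 would return to itself.
rotate²-derangement zero          ()
rotate²-derangement (suc zero)    ()
-- No wrap-around here: two steps lower the value by exactly 2, whence the implicit argument 1 of
-- `m≢1+n+m`.
rotate²-derangement (suc (suc i)) eq =
  m≢1+n+m (toℕ i) {1} (trans (sym (trans (toℕ-rotate-suc _) (toℕ-punchIn-fromℕ i))) (cong toℕ eq))

theorem2p6 : (t : ℕ) → 3 ≤ t → IsMagicConstant (4 * t + 2)
theorem2p6 (suc (suc (suc m))) (s≤s (s≤s (s≤s z≤n))) =
  z<s , graph , labelling , weight-constant
  -- `rotate {2 + m}` is a single cycle on `3 + m` points, and `3 + m` is the given t.
  where open TwinCycles (rotate {2 + m}) rotate-derangement rotate²-derangement
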